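{- Let $m,k$ be positive integers with $k\ge 3$. Suppose $D(mk,k)=\{d_0,d_1,\ldots,d_j\}$ for some $j\ge 0$, where $d_0<d_1<\cdots<d_j$, and let $d_{ -1}:=0$. Then $$mk-m\;\ge\; b(mk,k)\;\ge\; mk-\sum_{i=0}^{j}(d_i-d_{i-1})(m-d_i+1).$$
   Context: For positive integers $k,N,d$ with $k\ge 3$, a $k$-term cyclic arithmetic progression mod $N$ with common difference $d$ is a $k$-element subset of $\mathbb{Z}_N=\mathbb{Z}/N\mathbb{Z}$ of the form $\{t,t+d,\ldots,t+(k-1)d\}$ for some $t\in\mathbb{Z}_N$ (so these $k$ elements are pairwise distinct mod $N$). Progressions are sets, so the same progression may have several bases $t$ and common differences $d$. $b(N,k)$ denotes the maximum size of a subset $B\subseteq\mathbb{Z}_N$ that contains (as a subset) no $k$-term cyclic arithmetic progression mod $N$. $D(N,k)$ denotes the set of values $\gcd(d,k)$, where $d$ ranges over all possible common differences ($1\le d\le N-1$) of $k$-term cyclic arithmetic progressions mod $N$. -}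

module Defs where

open import Algebra.Definitions.RawMonoid using (sum)
open import Data.Bool.Base using (if_then_else_)
open import Data.Fin.Base using (Fin; zero; suc; toℕ; inject₁)
open import Data.Fin.Properties using (nonZeroIndex; any?; all?; toℕ-fromℕ<; toℕ-injective)
  renaming (_≟_ to _≟ᶠ_)
open import Data.Fin.Subset using (Subset; _∈_; _⊆_; ∣_∣; ⊥)
open import Data.Fin.Subset.Properties
  using (_∈?_; _⊆?_; anySubset?; ∣p∣≤n; ∣⊥∣≡0; p⊆q⇒∣p∣≤∣q∣)
open import Data.Integer.Base using (ℤ; +-0-rawMonoid)
open import Data.Nat.Base hiding (+-0-rawMonoid)
open import Data.Nat.DivMod
open import Data.Nat.GCD using (gcd)
open import Data.Nat.Properties
open import Data.Product.Base using (_×_; _,_; ∃; ∃₂; map₂)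
open import Data.Vec.Functional using (Vector)
open import Function.Bundles using (_⇔_; mk⇔; Equivalence)
open import Level using (0ℓ)
open import Relation.Binary.PropositionalEquality
open import Relation.Nullary
open import Relation.Nullary.Decidable using (map′)
open import Relation.Unary using (Pred; Decidable)

private
  variable
    N : ℕ

-- ℤ/Nℤ is represented by Fin N, its elements being the least residues.

term : Fin N → (d i : ℕ) → Fin N
term {N} t d i = _mod_ (toℕ t + i * d) N {{nonZeroIndex t}}

IsCyclicAP : (k d : ℕ) → Subset N → Set
IsCyclicAP {N} k d A =
  1 ≤ d × ∣ A ∣ ≡ k ×
  ∃ λ (t : Fin N) → ∀ x → x ∈ A ⇔ (∃ λ (i : Fin k) → x ≡ term t d (toℕ i))

ContainsAP : (k : ℕ) → Subset N → Set
ContainsAP k B = ∃₂ λ d A → IsCyclicAP k d A × A ⊆ B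

APFree : (k : ℕ) → Subset N → Set
APFree k B = ¬ ContainsAP k B

-- The bound 1 ≤ d is part of IsCyclicAP.
D : (N k : ℕ) → Pred ℕ 0ℓ
D N k g = ∃₂ λ d (A : Subset N) → d ≤ N ∸ 1 × IsCyclicAP k d A × gcd d k ≡ g

-- Deciding ContainsAP: d may be replaced by N + (d mod N), which is still
-- positive, so only finitely many differences have to be tried.

private
  _⇔-dec_ : {P Q : Set} → Dec P → Dec Q → Dec (P ⇔ Q)
  p? ⇔-dec q? = map′ (λ (f , g) → mk⇔ f g)
                     (λ e → Equivalence.to e , Equivalence.from e)
                     ((p? →-dec q?) ×-dec (q? →-dec p?))

  isCyclicAP? : ∀ k d (A : Subset N) → Dec (IsCyclicAP k d A)
  isCyclicAP? k d A =
    (1 ≤? d) ×-dec (∣ A ∣ ≟ k) ×-dec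
    any? λ t → all? λ x → (x ∈? A) ⇔-dec any? λ i → x ≟ᶠ term t d (toℕ i)

  %-absorb : ∀ a i d n .{{_ : NonZero n}} →
             (a + i * d) % n ≡ (a + i * (n + d % n)) % n
  %-absorb a i d n = begin
    (a + i * d) % n                          ≡⟨ %-distribˡ-+ a (i * d) n ⟩
    (a % n + (i * d) % n) % n                ≡⟨ cong (λ z → (a % n + z) % n) eq ⟩
    (a % n + (i * (n + d % n)) % n) % n      ≡⟨ %-distribˡ-+ a (i * (n + d % n)) n ⟨
    (a + i * (n + d % n)) % n                ∎
    where
    open ≡-Reasoning
    red : d % n ≡ (n + d % n) % n
    red = begin
      d % n               ≡⟨ m%n%n≡m%n d n ⟨
      d % n % n           ≡⟨ [m+n]%n≡m%n (d % n) n ⟨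
      (d % n + n) % n     ≡⟨ cong (_% n) (+-comm (d % n) n) ⟩
      (n + d % n) % n     ∎
    eq : (i * d) % n ≡ (i * (n + d % n)) % n
    eq = begin
      (i * d) % n                             ≡⟨ %-distribˡ-* i d n ⟩
      (i % n * (d % n)) % n                   ≡⟨ cong (λ z → (i % n * z) % n) red ⟩
      (i % n * ((n + d % n) % n)) % n         ≡⟨ %-distribˡ-* i (n + d % n) n ⟨
      (i * (n + d % n)) % n                   ∎

  term-reduce : ∀ {n} (t : Fin (suc n)) d i →
                term t d i ≡ term t (suc n + toℕ (d mod suc n)) i
  term-reduce {n} t d i = toℕ-injective (begin
    toℕ (term t d i)                                  ≡⟨ toℕ-fromℕ< _ ⟩
    (toℕ t + i * d) % suc n                           ≡⟨ %-absorb (toℕ t) i d (suc n) ⟩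
    (toℕ t + i * (suc n + d % suc n)) % suc n
      ≡⟨ cong (λ z → (toℕ t + i * (suc n + z)) % suc n) (toℕ-fromℕ< (m%n<n d (suc n))) ⟨
    (toℕ t + i * (suc n + toℕ (d mod suc n))) % suc n ≡⟨ toℕ-fromℕ< _ ⟨
    toℕ (term t (suc n + toℕ (d mod suc n)) i)        ∎)
    where open ≡-Reasoning

  IsCyclicAP-reduce : ∀ {k d} {A : Subset N} → IsCyclicAP k d A →
                      ∃ λ (e : Fin N) → IsCyclicAP k (N + toℕ e) A
  IsCyclicAP-reduce {suc n} {d = d} (_ , card , t , elems) =
    d mod suc n , s≤s z≤n , card , t , λ x →
      mk⇔ (λ x∈A → map₂ (λ {i} eq → trans eq (term-reduce t d (toℕ i)))
                        (Equivalence.to (elems x) x∈A))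
          (λ (i , eq) → Equivalence.from (elems x)
                          (i , trans eq (sym (term-reduce t d (toℕ i)))))

containsAP? : ∀ k (B : Subset N) → Dec (ContainsAP k B)
containsAP? {N} k B =
  map′ (λ (e , found) → N + toℕ e , found)
       (λ (d , A , ap , A⊆B) → let (e , ap′) = IsCyclicAP-reduce ap in
                               e , A , ap′ , λ {_} → A⊆B)
       (any? λ (e : Fin N) → anySubset? λ A →
          isCyclicAP? k (N + toℕ e) A ×-dec (A ⊆? B))

apFree? : ∀ k (B : Subset N) → Dec (APFree k B)
apFree? k B = ¬? (containsAP? k B)

-- The largest s ≤ n with P s, and 0 if there is none (for b and k ≥ 1 the
-- latter never matters, since the empty set is AP-free; see b-attained).
largest : {P : Pred ℕ 0ℓ} → Decidable P → ℕ → ℕ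
largest P? zero    = 0
largest P? (suc n) = if does (P? (suc n)) then suc n else largest P? n

APFreeSize : (N k : ℕ) → Pred ℕ 0ℓ
APFreeSize N k s = ∃ λ (B : Subset N) → ∣ B ∣ ≡ s × APFree k B

apFreeSize? : ∀ N k → Decidable (APFreeSize N k)
apFreeSize? N k s = anySubset? λ B → (∣ B ∣ ≟ s) ×-dec apFree? k B

b : (N k : ℕ) → ℕ
b N k = largest (apFreeSize? N k) N

private
  largest-upper : ∀ {P : Pred ℕ 0ℓ} (P? : Decidable P) {s} n →
                  s ≤ n → P s → s ≤ largest P? n
  largest-upper P? zero    s≤0 _ = s≤0
  largest-upper P? {s} (suc n) s≤1+n p with P? (suc n)
  ... | yes _ = s≤1+n
  ... | no ¬q = largest-upper P? n (≤-pred (≤∧≢⇒< s≤1+n λ { refl → ¬q p })) p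

  largest-sat : ∀ {P : Pred ℕ 0ℓ} (P? : Decidable P) n → P 0 → P (largest P? n)
  largest-sat P? zero    p = p
  largest-sat P? (suc n) p with P? (suc n)
  ... | yes q = q
  ... | no _  = largest-sat P? n p

b-attained : ∀ N k → 1 ≤ k → APFreeSize N k (b N k)
b-attained N k 1≤k = largest-sat (apFreeSize? N k) N (⊥ , ∣⊥∣≡0 N , λ where
  (d , A , (_ , card , _) , A⊆⊥) →
    <⇒≱ 1≤k (subst₂ _≤_ card (∣⊥∣≡0 N) (p⊆q⇒∣p∣≤∣q∣ A⊆⊥)))

b-upper : ∀ {N} k {B : Subset N} → APFree k B → ∣ B ∣ ≤ b N k
b-upper {N} k {B} free =
  largest-upper (apFreeSize? N k) N (∣p∣≤n B) (B , refl , free)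

-- d_{i-1}, where d_{-1} = 0.
previous : ∀ {j} → (Fin (suc j) → ℕ) → Fin (suc j) → ℕ
previous d zero    = 0
previous d (suc i) = d (inject₁ i)

sumℤ : ∀ {n} → Vector ℤ n → ℤ
sumℤ = sum +-0-rawMonoid

{-# OPTIONS --safe #-}

-- Upper bound: ℤ/mkℤ splits into m blocks of k consecutive residues, each of
-- which is a progression and so contains an element outside of B.
--
-- Lower bound: write x = k q + r with r < k. A progression whose difference d
-- has gcd g with k meets some class r < g modulo k in exactly g of the m
-- elements of that class, hence meets any set containing m + 1 - g of them. It
-- therefore suffices to remove, for d_{i-1} ≤ r < d_i, the m + 1 - d_i elements
-- with q < m + 1 - d_i.

module Submission where

open import Defs
open import Data.Bool.Base using (true)
open import Data.Fin.Base using (Fin; zero; suc; toℕ; fromℕ<; cast; combine; remQuot;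
  quotient; remainder; punchIn; punchOut; inject₁)
  renaming (_<_ to _<ᶠ_)
open import Data.Fin.Induction using (<-weakInduction)
open import Data.Fin.Properties as Fin
  using (toℕ-injective; toℕ-fromℕ<; toℕ-cast; toℕ<n; any?; injective⇒≤; punchIn-punchOut;
         combine-injectiveˡ; combine-injectiveʳ; combine-remQuot; remQuot-combine; toℕ-combine)
open import Data.Fin.Subset using (Subset; inside; outside; _∈_; ∣_∣; ⁅_⁆; _∩_; ∁) renaming (_-_ to _∖_)
open import Data.Fin.Subset.Properties
open import Data.Integer.Base as ℤ using (ℤ; +_; _+_; _-_; _*_; _≥_; 1ℤ)
import Data.Integer.Properties as ℤ
import Data.Integer.Tactic.RingSolver as ℤSolver
open import Data.Nat.Base as ℕ using (ℕ; zero; suc; NonZero; _∸_; z≤n; s≤s)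
open import Data.Nat.Divisibility hiding (quotient)
open import Data.Nat.DivMod
open import Data.Nat.GCD using (gcd; gcd[m,n]∣m; gcd[m,n]∣n; gcd-greatest; gcd[m,n]≢0; gcd[m,n]≤n; gcd-GCD; module Bézout)
import Data.Nat.Properties as ℕ
open import Data.Nat.Tactic.RingSolver using (solve-∀)
open import Data.Product.Base using (_×_; _,_; ∃; ∃₂; proj₁; proj₂; uncurry)
open import Data.Sum.Base using (inj₂)
open import Data.Vec.Base using ([]; _∷_; tabulate)
open import Data.Vec.Properties using (lookup∘tabulate; lookup⇒[]=; []=⇒lookup)
open import Function.Base using (_∘_; case_of_)
open import Function.Bundles using (mk⇔; Equivalence)
open import Function.Definitions using (Injective)
open import Relation.Binary.PropositionalEquality
open import Relation.Nullary
open import Relation.Nullary.Decidable using (dec-true; decidable-stable)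
open import Relation.Unary using (Pred; Decidable; _≐_)

private
  variable
    n N m k d : ℕ
    p : Subset n

-- Counting in finite subsets: coverings, injections and the pigeonhole principle.

subset : ∀ {ℓ} {P : Pred (Fin n) ℓ} → Decidable P → Subset n
subset P? = tabulate (does ∘ P?)

∈-subset⁺ : ∀ {ℓ} {P : Pred (Fin n) ℓ} (P? : Decidable P) {x} → P x → x ∈ subset P?
∈-subset⁺ P? {x} px = lookup⇒[]= x _ (trans (lookup∘tabulate _ x) (dec-true (P? x) px))

∈-subset⁻ : ∀ {ℓ} {P : Pred (Fin n) ℓ} (P? : Decidable P) {x} → x ∈ subset P? → P x
∈-subset⁻ P? {x} x∈ = witness (P? x) (trans (sym (lookup∘tabulate _ x)) ([]=⇒lookup x∈))
  where
  witness : ∀ {a} {A : Set a} (a? : Dec A) → does a? ≡ true → A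
  witness (yes a) _ = a

∣p∣≤∣q∣+∣p∩∁q∣ : (p q : Subset n) → ∣ p ∣ ℕ.≤ ∣ q ∣ ℕ.+ ∣ p ∩ ∁ q ∣
∣p∣≤∣q∣+∣p∩∁q∣ []            []            = z≤n
∣p∣≤∣q∣+∣p∩∁q∣ (outside ∷ p) (outside ∷ q) = ∣p∣≤∣q∣+∣p∩∁q∣ p q
∣p∣≤∣q∣+∣p∩∁q∣ (outside ∷ p) (inside ∷ q)  = ℕ.m≤n⇒m≤1+n (∣p∣≤∣q∣+∣p∩∁q∣ p q)
∣p∣≤∣q∣+∣p∩∁q∣ (inside ∷ p)  (outside ∷ q) =
  subst (suc ∣ p ∣ ℕ.≤_) (sym (ℕ.+-suc ∣ q ∣ _)) (s≤s (∣p∣≤∣q∣+∣p∩∁q∣ p q))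
∣p∣≤∣q∣+∣p∩∁q∣ (inside ∷ p)  (inside ∷ q)  = s≤s (∣p∣≤∣q∣+∣p∩∁q∣ p q)

Empty⇒∣p∣≡0 : (∀ {x} → ¬ x ∈ p) → ∣ p ∣ ≡ 0
Empty⇒∣p∣≡0 {n} empty = trans (cong ∣_∣ (Empty-unique λ (_ , x∈p) → empty x∈p)) (∣⊥∣≡0 n)

-- Induction on `n`: deleting `f zero` from `p` leaves a set covered by `f ∘ suc`.
covered⇒∣p∣≤ : (f : Fin n → Fin N) → (∀ {x} → x ∈ p → ∃ λ i → x ≡ f i) → ∣ p ∣ ℕ.≤ n
covered⇒∣p∣≤ {zero} {p = p} f cover =
  ℕ.≤-reflexive (Empty⇒∣p∣≡0 {p = p} λ x∈p → case cover x∈p of λ ())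
covered⇒∣p∣≤ {suc n} {p = p} f cover = begin
  ∣ p ∣                                     ≤⟨ ∣p∣≤∣q∣+∣p∩∁q∣ p ⁅ f zero ⁆ ⟩
  ∣ ⁅ f zero ⁆ ∣ ℕ.+ ∣ p ∩ ∁ ⁅ f zero ⁆ ∣  ≡⟨ cong (ℕ._+ ∣ p ∩ ∁ ⁅ f zero ⁆ ∣) (∣⁅x⁆∣≡1 (f zero)) ⟩
  suc ∣ p ∩ ∁ ⁅ f zero ⁆ ∣                 ≤⟨ s≤s (covered⇒∣p∣≤ (f ∘ suc) rest) ⟩
  suc n                                     ∎
  where
  open ℕ.≤-Reasoning
  rest : ∀ {x} → x ∈ p ∩ ∁ ⁅ f zero ⁆ → ∃ λ i → x ≡ f (suc i)
  rest x∈ with x∈p , x∈∁ ← x∈p∩q⁻ p _ x∈ with cover x∈p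
  ... | zero  , refl = contradiction (x∈⁅x⁆ _) (x∈∁p⇒x∉p x∈∁)
  ... | suc i , eq   = i , eq

-- The union bound, stated over the integers because the summands of the lower bound are integers.
∣p∣≤sumℤ : (R : Fin n → Subset N) {a : Fin n → ℤ} → (∀ i → + ∣ R i ∣ ℤ.≤ a i) →
           (∀ {x} → x ∈ p → ∃ λ i → x ∈ R i) → + ∣ p ∣ ℤ.≤ sumℤ a
∣p∣≤sumℤ {zero} {p = p} R bound cover =
  ℤ.≤-reflexive (cong +_ (Empty⇒∣p∣≡0 {p = p} λ x∈p → case cover x∈p of λ ()))
∣p∣≤sumℤ {suc n} {p = p} R bound cover = ℤ.≤-trans
  (ℤ.+≤+ (∣p∣≤∣q∣+∣p∩∁q∣ p (R zero)))
  (ℤ.+-mono-≤ (bound zero) (∣p∣≤sumℤ (R ∘ suc) (bound ∘ suc) rest))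
  where
  rest : ∀ {x} → x ∈ p ∩ ∁ (R zero) → ∃ λ i → x ∈ R (suc i)
  rest x∈ with x∈p , x∈∁ ← x∈p∩q⁻ p _ x∈ with cover x∈p
  ... | zero  , x∈R = contradiction x∈R (x∈∁p⇒x∉p x∈∁)
  ... | suc i , x∈R = i , x∈R

injective⇒≤∣p∣ : {f : Fin n → Fin N} → Injective _≡_ _≡_ f → (∀ i → f i ∈ p) → n ℕ.≤ ∣ p ∣
injective⇒≤∣p∣ {zero}                inj f∈p = z≤n
injective⇒≤∣p∣ {suc n} {p = p} {f} inj f∈p = ℕ.≤-<-trans
  (injective⇒≤∣p∣ {p = p ∖ f zero} (Fin.suc-injective ∘ inj) λ i →
     x∈p∧x≢y⇒x∈p-y (f∈p (suc i)) λ eq → case inj {suc i} {zero} eq of λ ())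
  (x∈p⇒∣p-x∣<∣p∣ (f∈p zero))

covered⇒injective : (f : Fin n → Fin N) → (∀ {x} → x ∈ p → ∃ λ i → x ≡ f i) → ∣ p ∣ ≡ n →
                    Injective _≡_ _≡_ f
covered⇒injective {suc n} {p = p} f cover card {i} {j} fi≡fj with i Fin.≟ j
... | yes i≡j = i≡j
... | no i≢j  = contradiction (covered⇒∣p∣≤ (f ∘ punchIn j) cover′) (ℕ.<⇒≱ (ℕ.≤-reflexive (sym card)))
  where
  -- The dropped index `j` is replaced by `i`, which has the same value; every other index is kept.
  avoid : ∀ l → ∃ λ l′ → f l ≡ f (punchIn j l′)
  avoid l with j Fin.≟ l
  ... | yes refl = punchOut (i≢j ∘ sym) , trans (sym fi≡fj) (cong f (sym (punchIn-punchOut (i≢j ∘ sym))))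
  ... | no j≢l   = punchOut j≢l , cong f (sym (punchIn-punchOut j≢l))
  cover′ : ∀ {x} → x ∈ p → ∃ λ l → x ≡ f (punchIn j l)
  cover′ x∈p with l , refl ← cover x∈p = avoid l

injective-interval : ∀ {lo hi} {f : Fin n → ℕ} → Injective _≡_ _≡_ f →
                     (∀ i → lo ℕ.≤ f i) → (∀ i → f i ℕ.< hi) → n ℕ.≤ hi ∸ lo
injective-interval {lo = lo} {hi} {f} inj lo≤ <hi = injective⇒≤ {f = g} g-injective
  where
  <hi∸lo : ∀ i → f i ∸ lo ℕ.< hi ∸ lo
  <hi∸lo i = ℕ.∸-monoˡ-< (<hi i) (lo≤ i)
  g : Fin _ → Fin (hi ∸ lo)
  g i = fromℕ< (<hi∸lo i)
  g-injective : Injective _≡_ _≡_ g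
  g-injective {i} {j} eq = inj (ℕ.∸-cancelʳ-≡ (lo≤ i) (lo≤ j) (begin
    f i ∸ lo   ≡⟨ toℕ-fromℕ< (<hi∸lo i) ⟨
    toℕ (g i)  ≡⟨ cong toℕ eq ⟩
    toℕ (g j)  ≡⟨ toℕ-fromℕ< (<hi∸lo j) ⟩
    f j ∸ lo   ∎))
    where open ≡-Reasoning

-- Distinctness of the terms, and reduction of the difference modulo `N`.

-- `IsCyclicAP` records only the elements and the cardinality `k`; since `k` terms cover `k`
-- elements, no two terms coincide.
term-injective : {A : Subset N} → (ap : IsCyclicAP k d A) →
                 Injective _≡_ _≡_ (λ (i : Fin k) → term (proj₁ (proj₂ (proj₂ ap))) d (toℕ i))
term-injective (_ , card , _ , elems) = covered⇒injective _ (λ {x} → Equivalence.to (elems x)) card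

toℕ-term : .{{_ : NonZero N}} (t : Fin N) (d i : ℕ) → toℕ (term t d i) ≡ (toℕ t ℕ.+ i ℕ.* d) % N
toℕ-term t d i = toℕ-fromℕ< _

term-% : .{{_ : NonZero N}} (t : Fin N) (d i : ℕ) → term t d i ≡ term t (d % N) i
term-% {N} t d i = toℕ-injective (begin
  toℕ (term t d i)                                    ≡⟨ toℕ-term t d i ⟩
  (toℕ t ℕ.+ i ℕ.* d) % N                             ≡⟨ cong (λ e → (toℕ t ℕ.+ i ℕ.* e) % N) (m≡m%n+[m/n]*n d N) ⟩
  (toℕ t ℕ.+ i ℕ.* (d % N ℕ.+ d / N ℕ.* N)) % N        ≡⟨ cong (_% N) (expand (toℕ t) i (d % N) (d / N) N) ⟩
  (toℕ t ℕ.+ i ℕ.* (d % N) ℕ.+ i ℕ.* (d / N) ℕ.* N) % N ≡⟨ [m+kn]%n≡m%n _ (i ℕ.* (d / N)) N ⟩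
  (toℕ t ℕ.+ i ℕ.* (d % N)) % N                       ≡⟨ toℕ-term t (d % N) i ⟨
  toℕ (term t (d % N) i)                              ∎)
  where
  open ≡-Reasoning
  expand : ∀ a i e q n → a ℕ.+ i ℕ.* (e ℕ.+ q ℕ.* n) ≡ a ℕ.+ i ℕ.* e ℕ.+ i ℕ.* q ℕ.* n
  expand = solve-∀

gcd-% : .{{_ : NonZero N}} → k ∣ N → ∀ d → gcd (d % N) k ≡ gcd d k
gcd-% {N} {k} k∣N d = ∣-antisym
  (gcd-greatest (∣n∣m%n⇒∣m (∣-trans (gcd[m,n]∣n (d % N) k) k∣N) (gcd[m,n]∣m (d % N) k)) (gcd[m,n]∣n (d % N) k))
  (gcd-greatest (%-presˡ-∣ (gcd[m,n]∣m d k) (∣-trans (gcd[m,n]∣n d k) k∣N)) (gcd[m,n]∣n d k))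

-- `IsCyclicAP` puts no upper bound on the difference, whereas `D` wants it below `N`. Passing to
-- `d % N` changes neither the terms nor, because `k` divides `N`, the gcd with `k`.
IsCyclicAP⇒D : k ∣ N → 2 ℕ.≤ k → {A : Subset N} → IsCyclicAP k d A → D N k (gcd d k)
IsCyclicAP⇒D {suc (suc k)} {suc N} {d} k∣N (s≤s (s≤s _)) {A} ap@(_ , card , t , elems) =
  d % suc N , A , ℕ.≤-pred (m%n<n d (suc N)) , (1≤ , card , t , elems′) , gcd-% k∣N d
  where
  -- If `N` divided `d`, the terms with indices 0 and 1 would coincide; both indices exist because
  -- `2 ≤ k`.
  1≤ : 1 ℕ.≤ d % suc N
  1≤ = ℕ.n≢0⇒n>0 λ e≡0 → case term-injective ap {zero} {suc zero} (begin
      term t d 0              ≡⟨ term-% t d 0 ⟩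
      term t (d % suc N) 0    ≡⟨ cong (λ e → term t e 0) e≡0 ⟩
      term t 0 1              ≡⟨ cong (λ e → term t e 1) e≡0 ⟨
      term t (d % suc N) 1    ≡⟨ term-% t d 1 ⟨
      term t d 1              ∎) of λ ()
    where open ≡-Reasoning
  elems′ : ∀ x → _
  elems′ x = mk⇔ (λ x∈A → let i , eq = Equivalence.to (elems x) x∈A in i , trans eq (term-% t d (toℕ i)))
                 (λ (i , eq) → Equivalence.from (elems x) (i , trans eq (sym (term-% t d (toℕ i)))))

-- The elements of a progression in a residue class modulo `k`.

-- Write `T = r + u g` with `g = gcd d k`. By Bézout, `g` is a multiple of `d` modulo `k`, so some
-- `i` makes `i d` cancel `u g` modulo `k`.
reach-residue : ∀ T d k .{{_ : NonZero k}} .{{_ : NonZero (gcd d k)}} →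
                ∃₂ λ i w → T ℕ.+ i ℕ.* d ≡ T % gcd d k ℕ.+ w ℕ.* k
reach-residue T d k@(suc k-1) with Bézout.identity (gcd-GCD d k)
... | Bézout.-+ x y eq = u ℕ.* x , u ℕ.* y , (begin
    T ℕ.+ u ℕ.* x ℕ.* d                  ≡⟨ cong (ℕ._+ u ℕ.* x ℕ.* d) (m≡m%n+[m/n]*n T g) ⟩
    r ℕ.+ u ℕ.* g ℕ.+ u ℕ.* x ℕ.* d      ≡⟨ collect r u g x d ⟩
    r ℕ.+ u ℕ.* (g ℕ.+ x ℕ.* d)          ≡⟨ cong (λ z → r ℕ.+ u ℕ.* z) eq ⟩
    r ℕ.+ u ℕ.* (y ℕ.* k)                ≡⟨ cong (r ℕ.+_) (ℕ.*-assoc u y k) ⟨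
    r ℕ.+ u ℕ.* y ℕ.* k                  ∎)
  where
  open ≡-Reasoning
  g = gcd d k
  r = T % g
  u = T / g
  collect : ∀ r u g x d → r ℕ.+ u ℕ.* g ℕ.+ u ℕ.* x ℕ.* d ≡ r ℕ.+ u ℕ.* (g ℕ.+ x ℕ.* d)
  collect = solve-∀
-- Here `x d` is `g` rather than `-g` modulo `k`, so the index should be `-u x`; the factor `k-1`
-- stands for `-1` modulo `k` and keeps it natural.
... | Bézout.+- x y eq = k-1 ℕ.* u ℕ.* x , u ℕ.* g ℕ.+ k-1 ℕ.* u ℕ.* y , (begin
    T ℕ.+ k-1 ℕ.* u ℕ.* x ℕ.* d                      ≡⟨ cong (ℕ._+ k-1 ℕ.* u ℕ.* x ℕ.* d) (m≡m%n+[m/n]*n T g) ⟩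
    r ℕ.+ u ℕ.* g ℕ.+ k-1 ℕ.* u ℕ.* x ℕ.* d          ≡⟨ cong (r ℕ.+ u ℕ.* g ℕ.+_) (ℕ.*-assoc (k-1 ℕ.* u) x d) ⟩
    r ℕ.+ u ℕ.* g ℕ.+ k-1 ℕ.* u ℕ.* (x ℕ.* d)        ≡⟨ cong (λ z → r ℕ.+ u ℕ.* g ℕ.+ k-1 ℕ.* u ℕ.* z) eq ⟨
    r ℕ.+ u ℕ.* g ℕ.+ k-1 ℕ.* u ℕ.* (g ℕ.+ y ℕ.* k)  ≡⟨ collect r u g y k-1 ⟩
    r ℕ.+ (u ℕ.* g ℕ.+ k-1 ℕ.* u ℕ.* y) ℕ.* k        ∎)
  where
  open ≡-Reasoning
  g = gcd d k
  r = T % g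
  u = T / g
  collect : ∀ r u g y l → r ℕ.+ u ℕ.* g ℕ.+ l ℕ.* u ℕ.* (g ℕ.+ y ℕ.* suc l) ≡
                          r ℕ.+ (u ℕ.* g ℕ.+ l ℕ.* u ℕ.* y) ℕ.* suc l
  collect = solve-∀

combine-% : .{{_ : NonZero k}} (q : Fin m) (r : Fin k) → toℕ (combine q r) % k ≡ toℕ r
combine-% {k} q r = begin
  toℕ (combine q r) % k              ≡⟨ cong (_% k) (toℕ-combine q r) ⟩
  (k ℕ.* toℕ q ℕ.+ toℕ r) % k        ≡⟨ %-remove-+ˡ (toℕ r) (m∣m*n (toℕ q)) ⟩
  toℕ r % k                          ≡⟨ m<n⇒m%n≡m (toℕ<n r) ⟩
  toℕ r                              ∎
  where open ≡-Reasoning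

%⇒combine : .{{_ : NonZero k}} (x : Fin (m ℕ.* k)) (r : Fin k) → toℕ x % k ≡ toℕ r →
            ∃ λ (q : Fin m) → combine q r ≡ x
%⇒combine {k} {m} x r x%k≡r = q , trans (cong (combine q) r≡r′) (combine-remQuot {m} k x)
  where
  q = proj₁ (remQuot {m} k x)
  r′ = proj₂ (remQuot {m} k x)
  r≡r′ : r ≡ r′
  r≡r′ = toℕ-injective (begin
    toℕ r                       ≡⟨ x%k≡r ⟨
    toℕ x % k                   ≡⟨ cong (λ y → toℕ y % k) (combine-remQuot {m} k x) ⟨
    toℕ (combine q r′) % k      ≡⟨ combine-% q r′ ⟩
    toℕ r′                      ∎)
    where open ≡-Reasoning

-- With g = gcd d k and c = k / g, the indices i < k with T + i d ≡ T % g modulo k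
-- form a residue class modulo c, because c d is a multiple of k.
residue-indices : ∀ T d k .{{_ : NonZero k}} .{{_ : NonZero (gcd d k)}} →
                  ∃ λ (f : Fin (gcd d k) → Fin k) → Injective _≡_ _≡_ f ×
                  ∀ s → (T ℕ.+ toℕ (f s) ℕ.* d) % k ≡ T % gcd d k
residue-indices T d k with reach-residue T d k | gcd[m,n]∣m d k | gcd[m,n]∣n d k
... | i , w , reach | divides d′ d≡d′g | divides c k≡cg = f , f-injective , f-residue
  where
  g = gcd d k
  instance
    c≢0 : NonZero c
    c≢0 = ℕ.≢-nonZero λ c≡0 → ℕ.≢-nonZero⁻¹ k (trans k≡cg (cong (ℕ._* g) c≡0))
  gc≡k : g ℕ.* c ≡ k
  gc≡k = trans (ℕ.*-comm g c) (sym k≡cg)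
  -- Among the `k = g c` indices, those congruent to `i` modulo `c` are `c s + i′` with `s < g`.
  i′ = i mod c
  f : Fin g → Fin k
  f s = cast gc≡k (combine s i′)
  toℕ-f : ∀ s → toℕ (f s) ≡ c ℕ.* toℕ s ℕ.+ i % c
  toℕ-f s = begin
    toℕ (f s)                     ≡⟨ toℕ-cast gc≡k (combine s i′) ⟩
    toℕ (combine s i′)            ≡⟨ toℕ-combine s i′ ⟩
    c ℕ.* toℕ s ℕ.+ toℕ i′        ≡⟨ cong (c ℕ.* toℕ s ℕ.+_) (toℕ-fromℕ< (m%n<n i c)) ⟩
    c ℕ.* toℕ s ℕ.+ i % c         ∎
    where open ≡-Reasoning
  f-injective : Injective _≡_ _≡_ f
  f-injective {s} {s′} eq = combine-injectiveˡ s i′ s′ i′ (toℕ-injective (begin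
    toℕ (combine s i′)     ≡⟨ toℕ-cast gc≡k _ ⟨
    toℕ (f s)              ≡⟨ cong toℕ eq ⟩
    toℕ (f s′)             ≡⟨ toℕ-cast gc≡k _ ⟩
    toℕ (combine s′ i′)    ∎))
    where open ≡-Reasoning
  -- As `c d = d′ k`, moving an index by a multiple of `c` costs a multiple of `k`. Such multiples
  -- are added on both sides, which avoids subtraction.
  regroup : ∀ T c s i′ e d′ g →
            T ℕ.+ (c ℕ.* s ℕ.+ i′) ℕ.* (d′ ℕ.* g) ℕ.+ e ℕ.* d′ ℕ.* (c ℕ.* g) ≡
            T ℕ.+ (i′ ℕ.+ e ℕ.* c) ℕ.* (d′ ℕ.* g) ℕ.+ s ℕ.* d′ ℕ.* (c ℕ.* g)
  regroup = solve-∀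
  f-residue : ∀ s → (T ℕ.+ toℕ (f s) ℕ.* d) % k ≡ T % g
  f-residue s = begin
    (T ℕ.+ toℕ (f s) ℕ.* d) % k
      ≡⟨ cong (λ z → (T ℕ.+ z ℕ.* d) % k) (toℕ-f s) ⟩
    (T ℕ.+ (c ℕ.* toℕ s ℕ.+ i % c) ℕ.* d) % k
      ≡⟨ [m+kn]%n≡m%n _ (i / c ℕ.* d′) k ⟨
    (T ℕ.+ (c ℕ.* toℕ s ℕ.+ i % c) ℕ.* d ℕ.+ i / c ℕ.* d′ ℕ.* k) % k
      ≡⟨ cong (_% k) (cong₂ (λ y z → T ℕ.+ (c ℕ.* toℕ s ℕ.+ i % c) ℕ.* y ℕ.+ i / c ℕ.* d′ ℕ.* z) d≡d′g k≡cg) ⟩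
    (T ℕ.+ (c ℕ.* toℕ s ℕ.+ i % c) ℕ.* (d′ ℕ.* g) ℕ.+ i / c ℕ.* d′ ℕ.* (c ℕ.* g)) % k
      ≡⟨ cong (_% k) (regroup T c (toℕ s) (i % c) (i / c) d′ g) ⟩
    (T ℕ.+ (i % c ℕ.+ i / c ℕ.* c) ℕ.* (d′ ℕ.* g) ℕ.+ toℕ s ℕ.* d′ ℕ.* (c ℕ.* g)) % k
      ≡⟨ cong (_% k) (cong₂ (λ y z → T ℕ.+ (i % c ℕ.+ i / c ℕ.* c) ℕ.* y ℕ.+ toℕ s ℕ.* d′ ℕ.* z) d≡d′g k≡cg) ⟨
    (T ℕ.+ (i % c ℕ.+ i / c ℕ.* c) ℕ.* d ℕ.+ toℕ s ℕ.* d′ ℕ.* k) % k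
      ≡⟨ [m+kn]%n≡m%n _ (toℕ s ℕ.* d′) k ⟩
    (T ℕ.+ (i % c ℕ.+ i / c ℕ.* c) ℕ.* d) % k
      ≡⟨ cong (λ z → (T ℕ.+ z ℕ.* d) % k) (m≡m%n+[m/n]*n i c) ⟨
    (T ℕ.+ i ℕ.* d) % k
      ≡⟨ cong (_% k) reach ⟩
    (T % g ℕ.+ w ℕ.* k) % k
      ≡⟨ [m+kn]%n≡m%n (T % g) w k ⟩
    T % g % k
      ≡⟨ m<n⇒m%n≡m (ℕ.<-≤-trans (m%n<n T g) (gcd[m,n]≤n d k)) ⟩
    T % g
      ∎
    where open ≡-Reasoning

-- The terms given by `residue-indices` lie in the class `r = t % g` modulo `k`, and reducing modulo
-- `m k` first does not affect this. Being distinct with equal remainder, they have distinct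
-- quotients `h s`. The gcd is a variable bound by an equation so that it can be replaced by some
-- `d i`.
residue-fibre : .{{_ : NonZero k}} .{{_ : NonZero (m ℕ.* k)}} {A : Subset (m ℕ.* k)} →
                IsCyclicAP k d A → ∀ {g} → gcd d k ≡ g →
                ∃ λ (r : Fin k) → toℕ r ℕ.< g ×
                ∃ λ (h : Fin g → Fin m) → Injective _≡_ _≡_ h × (∀ s → combine (h s) r ∈ A)
residue-fibre {k} {m} {d} {A} ap@(_ , _ , t , elems) refl =
  r , subst (ℕ._< g) (sym toℕ-r) (m%n<n (toℕ t) g) , h , h-injective , h∈A
  where
  g = gcd d k
  instance
    g≢0 : NonZero g
    g≢0 = ℕ.≢-nonZero (gcd[m,n]≢0 d k (inj₂ (ℕ.≢-nonZero⁻¹ k)))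
  r<k : toℕ t % g ℕ.< k
  r<k = ℕ.<-≤-trans (m%n<n (toℕ t) g) (gcd[m,n]≤n d k)
  r : Fin k
  r = fromℕ< r<k
  toℕ-r : toℕ r ≡ toℕ t % g
  toℕ-r = toℕ-fromℕ< r<k
  indices = residue-indices (toℕ t) d k
  f : Fin g → Fin k
  f = proj₁ indices
  x : Fin g → Fin (m ℕ.* k)
  x s = term t d (toℕ (f s))
  x%k≡r : ∀ s → toℕ (x s) % k ≡ toℕ r
  x%k≡r s = begin
    toℕ (x s) % k                                     ≡⟨ cong (_% k) (toℕ-term t d (toℕ (f s))) ⟩
    (toℕ t ℕ.+ toℕ (f s) ℕ.* d) % (m ℕ.* k) % k       ≡⟨ m∣n⇒o%n%m≡o%m k (m ℕ.* k) _ (n∣m*n m) ⟩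
    (toℕ t ℕ.+ toℕ (f s) ℕ.* d) % k                   ≡⟨ proj₂ (proj₂ indices) s ⟩
    toℕ t % g                                         ≡⟨ toℕ-r ⟨
    toℕ r                                             ∎
    where open ≡-Reasoning
  h : Fin g → Fin m
  h s = proj₁ (%⇒combine {m = m} (x s) r (x%k≡r s))
  h-combine : ∀ s → combine (h s) r ≡ x s
  h-combine s = proj₂ (%⇒combine {m = m} (x s) r (x%k≡r s))
  h-injective : Injective _≡_ _≡_ h
  h-injective {s} {s′} eq = proj₁ (proj₂ indices) (term-injective ap
    (trans (sym (h-combine s)) (trans (cong (λ q → combine q r) eq) (h-combine s′))))
  h∈A : ∀ s → combine (h s) r ∈ A
  h∈A s = Equivalence.from (elems _) (f s , h-combine s)

-- The `g` distinct quotients from `residue-fibre` all lie in `Fin m`. This is what makes the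
-- truncated subtraction `suc m ∸ d i` exact later on.
gcd≤m : .{{_ : NonZero k}} .{{_ : NonZero (m ℕ.* k)}} {A : Subset (m ℕ.* k)} →
        IsCyclicAP k d A → ∀ {g} → gcd d k ≡ g → g ℕ.≤ m
gcd≤m {m = m} ap eq = let _ , _ , h , h-injective , _ = residue-fibre {m = m} ap eq in
  injective⇒≤ {f = h} h-injective

-- The upper bound: disjoint blocks of consecutive residues.

-- The numbers `k q + r` with `r < k` form a progression of difference 1 from `k q`; all are below
-- `m k`, so nothing wraps around.
block-isCyclicAP : .{{_ : NonZero k}} (q : Fin m) →
                   IsCyclicAP k 1 (subset λ x → any? λ r → x Fin.≟ combine {m} {k} q r)
block-isCyclicAP {k@(suc _)} {m} q = s≤s z≤n , card , combine q zero , λ x →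
    mk⇔ (λ x∈ → let r , eq = ∈-subset⁻ block? x∈ in r , trans eq (sym (term-block r)))
        (λ (r , eq) → ∈-subset⁺ block? (r , trans eq (term-block r)))
  where
  block? : Decidable λ x → ∃ λ r → x ≡ combine {m} {k} q r
  block? x = any? λ r → x Fin.≟ combine q r
  card : ∣ subset block? ∣ ≡ k
  card = ℕ.≤-antisym
    (covered⇒∣p∣≤ {p = subset block?} (combine q) (∈-subset⁻ block?))
    (injective⇒≤∣p∣ {p = subset block?} (combine-injectiveʳ q _ q _) λ r → ∈-subset⁺ block? (r , refl))
  t = combine {m} {k} q zero
  instance
    mk≢0 : NonZero (m ℕ.* k)
    mk≢0 = Fin.nonZeroIndex t
  t+r : ∀ r → toℕ t ℕ.+ toℕ r ℕ.* 1 ≡ toℕ (combine q r)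
  t+r r = begin
    toℕ t ℕ.+ toℕ r ℕ.* 1           ≡⟨ cong₂ ℕ._+_ (toℕ-combine {m} {k} q zero) (ℕ.*-identityʳ (toℕ r)) ⟩
    k ℕ.* toℕ q ℕ.+ 0 ℕ.+ toℕ r     ≡⟨ cong (ℕ._+ toℕ r) (ℕ.+-identityʳ (k ℕ.* toℕ q)) ⟩
    k ℕ.* toℕ q ℕ.+ toℕ r           ≡⟨ toℕ-combine q r ⟨
    toℕ (combine q r)               ∎
    where open ≡-Reasoning
  term-block : ∀ r → term t 1 (toℕ r) ≡ combine q r
  term-block r = toℕ-injective (begin
    toℕ (term t 1 (toℕ r))                      ≡⟨ toℕ-term t 1 (toℕ r) ⟩
    (toℕ t ℕ.+ toℕ r ℕ.* 1) % (m ℕ.* k)         ≡⟨ cong (_% (m ℕ.* k)) (t+r r) ⟩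
    toℕ (combine q r) % (m ℕ.* k)               ≡⟨ m<n⇒m%n≡m (toℕ<n (combine q r)) ⟩
    toℕ (combine q r)                           ∎)
    where open ≡-Reasoning

APFree⇒∣B∣≤ : .{{_ : NonZero k}} {B : Subset (m ℕ.* k)} → APFree k B → ∣ B ∣ ℕ.≤ m ℕ.* k ∸ m
APFree⇒∣B∣≤ {k} {m} {B} free = ℕ.m+n≤o⇒m≤o∸n ∣ B ∣ (begin
  ∣ B ∣ ℕ.+ m                    ≤⟨ ℕ.+-monoʳ-≤ ∣ B ∣ m≤∣∁B∣ ⟩
  ∣ B ∣ ℕ.+ ∣ ∁ B ∣              ≡⟨ cong (∣ B ∣ ℕ.+_) (∣∁p∣≡n∸∣p∣ B) ⟩
  ∣ B ∣ ℕ.+ (m ℕ.* k ∸ ∣ B ∣)    ≡⟨ ℕ.m+[n∸m]≡n (∣p∣≤n B) ⟩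
  m ℕ.* k                        ∎)
  where
  open ℕ.≤-Reasoning
  missing : ∀ (q : Fin m) → ∃ λ (r : Fin k) → combine q r ∈ ∁ B
  -- Membership is decidable, so it is enough to refute that the block has no element outside `B`:
  -- the block would then be a progression inside `B`.
  missing q = decidable-stable (any? λ r → combine q r ∈? ∁ B) λ none →
    free (1 , _ , block-isCyclicAP {k} {m} q , λ x∈ →
      case ∈-subset⁻ (λ x → any? λ r → x Fin.≟ combine {m} {k} q r) x∈ of λ where
        (r , refl) → x∉∁p⇒x∈p λ x∈∁ → none (r , x∈∁))
  m≤∣∁B∣ : m ℕ.≤ ∣ ∁ B ∣
  m≤∣∁B∣ = injective⇒≤∣p∣ {p = ∁ B} {f = λ q → combine q (proj₁ (missing q))}
    (λ {q} {q′} → combine-injectiveˡ q (proj₁ (missing q)) q′ (proj₁ (missing q′)))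
    (proj₂ ∘ missing)

-- The lower bound: a set that meets every progression.

-- As suc m ∸ d i decreases with i, only the least i with r < d i matters.
hitting? : (m k : ℕ) (d : Fin n → ℕ) →
           Decidable λ (x : Fin (m ℕ.* k)) →
             ∃ λ i → toℕ (remainder {m} k x) ℕ.< d i × toℕ (quotient {m} k x) ℕ.< suc m ∸ d i
hitting? m k d x = any? λ i → (_ ℕ.<? d i) ×-dec (_ ℕ.<? suc m ∸ d i)

hittingSet : (m k : ℕ) (d : Fin n → ℕ) → Subset (m ℕ.* k)
hittingSet m k d = subset (hitting? m k d)

-- A progression avoiding the hitting set would have `d i` distinct quotients in the interval from
-- `suc m ∸ d i` to `m - 1`, which has only `d i - 1` elements.
∁hittingSet-APFree : .{{_ : NonZero k}} .{{_ : NonZero (m ℕ.* k)}} (d : Fin n → ℕ) →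
  (∀ {e} {A : Subset (m ℕ.* k)} → IsCyclicAP k e A → ∃ λ i → gcd e k ≡ d i) →
  APFree k (∁ (hittingSet m k d))
∁hittingSet-APFree {k} {m} d gcd∈d (e , A , ap , A⊆∁H) =
  let i , gcd≡dᵢ = gcd∈d ap
      r , r<dᵢ , h , h-injective , h∈A = residue-fibre {m = m} ap gcd≡dᵢ
      lo = suc m ∸ d i
      lo≤h : ∀ s → lo ℕ.≤ toℕ (h s)
      lo≤h s = ℕ.≮⇒≥ λ h<lo → x∈∁p⇒x∉p (A⊆∁H (h∈A s)) (∈-subset⁺ (hitting? m k d)
        ( i
        , subst (ℕ._< d i) (cong (toℕ ∘ proj₂) (sym (remQuot-combine (h s) r))) r<dᵢ
        , subst (ℕ._< lo) (cong (toℕ ∘ proj₁) (sym (remQuot-combine (h s) r))) h<lo))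
      -- This amounts to `d i ≥ 1`: as `r < d i`, there is an index at which to evaluate `h`. It is
      -- needed to undo the truncation in `m ∸ lo`.
      lo≤m : lo ℕ.≤ m
      lo≤m = ℕ.<⇒≤ (ℕ.≤-<-trans (lo≤h (fromℕ< r<dᵢ)) (toℕ<n (h (fromℕ< r<dᵢ))))
  in ℕ.1+n≰n (begin
    suc m          ≡⟨ ℕ.m+[n∸m]≡n (ℕ.m≤n⇒m≤1+n (gcd≤m {m = m} ap gcd≡dᵢ)) ⟨
    d i ℕ.+ lo     ≤⟨ ℕ.m≤o∸n⇒m+n≤o (d i) lo≤m
                        (injective-interval (h-injective ∘ toℕ-injective) lo≤h (toℕ<n ∘ h)) ⟩
    m              ∎)
  where open ℕ.≤-Reasoning

-- The size of the hitting set, by a decomposition into strips.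

strip? : (m k lo hi t : ℕ) →
         Decidable λ (x : Fin (m ℕ.* k)) →
           (lo ℕ.≤ toℕ (remainder {m} k x) × toℕ (remainder {m} k x) ℕ.< hi) × toℕ (quotient {m} k x) ℕ.< t
strip? m k lo hi t x = ((lo ℕ.≤? _) ×-dec (_ ℕ.<? hi)) ×-dec (_ ℕ.<? t)

∣strip∣≤ : ∀ m k lo hi t .{{_ : NonZero (m ℕ.* k)}} → ∣ subset (strip? m k lo hi t) ∣ ℕ.≤ (hi ∸ lo) ℕ.* t
∣strip∣≤ m k lo hi t = covered⇒∣p∣≤ {p = subset (strip? m k lo hi t)} (uncurry point ∘ remQuot t) cover
  where
  point : Fin (hi ∸ lo) → Fin t → Fin (m ℕ.* k)
  -- Neither `hi ≤ k` nor `t ≤ m` is assumed, so the sum may leave the range; `mod` makes `point`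
  -- total and changes nothing at the points of the strip.
  point u v = (k ℕ.* toℕ v ℕ.+ (lo ℕ.+ toℕ u)) mod (m ℕ.* k)
  cover : ∀ {x} → x ∈ subset (strip? m k lo hi t) → ∃ λ s → x ≡ uncurry point (remQuot t s)
  cover {x} x∈ with (lo≤r , r<hi) , q<t ← ∈-subset⁻ (strip? m k lo hi t) x∈ =
    combine u v , trans (sym point≡x) (cong (uncurry point) (sym (remQuot-combine u v)))
    where
    open ≡-Reasoning
    q = quotient {m} k x
    r = remainder {m} k x
    r∸lo< : toℕ r ∸ lo ℕ.< hi ∸ lo
    r∸lo< = ℕ.∸-monoˡ-< r<hi lo≤r
    u = fromℕ< r∸lo<
    v = fromℕ< q<t
    point≡x : point u v ≡ x
    point≡x = toℕ-injective (begin
      toℕ (point u v)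
        ≡⟨ toℕ-fromℕ< _ ⟩
      (k ℕ.* toℕ v ℕ.+ (lo ℕ.+ toℕ u)) % (m ℕ.* k)
        ≡⟨ cong₂ (λ y z → (k ℕ.* y ℕ.+ (lo ℕ.+ z)) % (m ℕ.* k)) (toℕ-fromℕ< q<t) (toℕ-fromℕ< r∸lo<) ⟩
      (k ℕ.* toℕ q ℕ.+ (lo ℕ.+ (toℕ r ∸ lo))) % (m ℕ.* k)
        ≡⟨ cong (λ z → (k ℕ.* toℕ q ℕ.+ z) % (m ℕ.* k)) (ℕ.m+[n∸m]≡n lo≤r) ⟩
      (k ℕ.* toℕ q ℕ.+ toℕ r) % (m ℕ.* k)
        ≡⟨ cong (_% (m ℕ.* k)) (toℕ-combine q r) ⟨
      toℕ (combine q r) % (m ℕ.* k)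
        ≡⟨ cong (λ y → toℕ y % (m ℕ.* k)) (combine-remQuot {m} k x) ⟩
      toℕ x % (m ℕ.* k)
        ≡⟨ m<n⇒m%n≡m (toℕ<n x) ⟩
      toℕ x ∎)

+-∸ : ∀ {m n} → n ℕ.≤ m → + (m ∸ n) ≡ + m - + n
+-∸ {m} {n} n≤m = sym (trans (ℤ.[+m]-[+n]≡m⊖n m n) (ℤ.⊖-≥ n≤m))

module _ {j : ℕ} (d : Fin (suc j) → ℕ) (d-mono : ∀ {i i′} → i <ᶠ i′ → d i ℕ.< d i′) where

  d-step : ∀ i → d (inject₁ i) ℕ.≤ d (suc i)
  d-step i = ℕ.<⇒≤ (d-mono (s≤s (ℕ.≤-reflexive (Fin.toℕ-inject₁ i))))

  previous≤ : ∀ i → previous d i ℕ.≤ d i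
  previous≤ zero    = z≤n
  previous≤ (suc i) = d-step i

  -- Descend from `i` until the preceding value of `d` is at most `r`. The bound `d l ≤ d i` is kept
  -- because it gives `suc m ∸ d i ≤ suc m ∸ d l`, which carries the condition on the quotient from
  -- `i` to `l`.
  bracket : ∀ r i → r ℕ.< d i → ∃ λ l → (previous d l ℕ.≤ r × r ℕ.< d l) × d l ℕ.≤ d i
  bracket r = <-weakInduction (λ i → r ℕ.< d i → ∃ λ l → (previous d l ℕ.≤ r × r ℕ.< d l) × d l ℕ.≤ d i)
    (λ r<d₀ → zero , (z≤n , r<d₀) , ℕ.≤-refl)
    λ i below r<d → case r ℕ.<? d (inject₁ i) of λ where
      (yes r<) → let l , in-bracket , dₗ≤ = below r< in l , in-bracket , ℕ.≤-trans dₗ≤ (d-step i)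
      (no r≮)  → suc i , (ℕ.≮⇒≥ r≮ , r<d) , ℕ.≤-refl

  -- By `bracket`, every element of the hitting set lies in the strip `previous d l ≤ r < d l`,
  -- `q < suc m ∸ d l` for some `l`. These strips have the sizes in the sum, the subtractions being
  -- exact because `d` is monotone and `d i ≤ m`.
  ∣hittingSet∣≤ : ∀ m k .{{_ : NonZero (m ℕ.* k)}} → (∀ i → d i ℕ.≤ m) →
                  + ∣ hittingSet m k d ∣ ℤ.≤ sumℤ (λ i → (+ d i - + previous d i) * (+ m - + d i + 1ℤ))
  ∣hittingSet∣≤ m k d≤m = ∣p∣≤sumℤ {p = hittingSet m k d} (subset ∘ strips?) size cover
    where
    strips? = λ i → strip? m k (previous d i) (d i) (suc m ∸ d i)
    1+a-b : ∀ a b → 1ℤ + a - b ≡ a - b + 1ℤ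
    1+a-b = ℤSolver.solve-∀
    size : ∀ i → + ∣ subset (strips? i) ∣ ℤ.≤ (+ d i - + previous d i) * (+ m - + d i + 1ℤ)
    size i = begin
      + ∣ subset (strips? i) ∣                            ≤⟨ ℤ.+≤+ (∣strip∣≤ m k (previous d i) (d i) (suc m ∸ d i)) ⟩
      + ((d i ∸ previous d i) ℕ.* (suc m ∸ d i))          ≡⟨ ℤ.pos-* (d i ∸ previous d i) (suc m ∸ d i) ⟩
      + (d i ∸ previous d i) * + (suc m ∸ d i)            ≡⟨ cong₂ _*_ (+-∸ (previous≤ i)) (+-∸ (ℕ.m≤n⇒m≤1+n (d≤m i))) ⟩
      (+ d i - + previous d i) * (1ℤ + + m - + d i)       ≡⟨ cong ((+ d i - + previous d i) *_) (1+a-b (+ m) (+ d i)) ⟩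
      (+ d i - + previous d i) * (+ m - + d i + 1ℤ)       ∎
      where open ℤ.≤-Reasoning
    cover : ∀ {x} → x ∈ hittingSet m k d → ∃ λ i → x ∈ subset (strips? i)
    cover x∈ with i , r<dᵢ , q< ← ∈-subset⁻ (hitting? m k d) x∈ with l , in-bracket , dₗ≤dᵢ ← bracket _ i r<dᵢ =
      l , ∈-subset⁺ (strips? l) (in-bracket , ℕ.<-≤-trans q< (ℕ.∸-monoʳ-≤ (suc m) dₗ≤dᵢ))

theorem1p3 : (m k : ℕ) → 1 ℕ.≤ m → 3 ℕ.≤ k →
    (j : ℕ) (d : Fin (suc j) → ℕ) →
    (∀ {i i′} → i <ᶠ i′ → d i ℕ.< d i′) →
    D (m ℕ.* k) k ≐ (λ g → ∃ λ i → g ≡ d i) →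
    (+ (m ℕ.* k) - + m ≥ + b (m ℕ.* k) k) ×
    (+ b (m ℕ.* k) k ≥ + (m ℕ.* k) - sumℤ (λ i → (+ d i - + previous d i) * (+ m - + d i + 1ℤ)))
theorem1p3 m k 1≤m 3≤k j d d-mono (D⊆d , d⊆D) = upper , lower
  where
  open ℤ.≤-Reasoning
  1≤k : 1 ℕ.≤ k
  1≤k = ℕ.≤-trans (s≤s z≤n) 3≤k
  instance
    k≢0 : NonZero k
    k≢0 = ℕ.>-nonZero 1≤k
    mk≢0 : NonZero (m ℕ.* k)
    mk≢0 = ℕ.m*n≢0 m k {{ℕ.>-nonZero 1≤m}}
  mk = m ℕ.* k
  H = hittingSet m k d
  S = sumℤ (λ i → (+ d i - + previous d i) * (+ m - + d i + 1ℤ))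
  upper : + b mk k ℤ.≤ + mk - + m
  upper with B , ∣B∣≡b , free ← b-attained mk k 1≤k = begin
    + b mk k     ≡⟨ cong +_ ∣B∣≡b ⟨
    + ∣ B ∣      ≤⟨ ℤ.+≤+ (APFree⇒∣B∣≤ {k} {m} free) ⟩
    + (mk ∸ m)   ≡⟨ +-∸ (ℕ.m≤m*n m k) ⟩
    + mk - + m   ∎
  -- Each `d i` belongs to `D`, hence is the gcd of an actual progression, to which `gcd≤m` applies.
  d≤m : ∀ i → d i ℕ.≤ m
  d≤m i with e , A , _ , ap , gcd≡dᵢ ← d⊆D {d i} (i , refl) = gcd≤m {m = m} ap gcd≡dᵢ
  -- The other inclusion: every progression, once its difference is reduced, has its gcd among the
  -- `d i`.
  free : APFree k (∁ H)
  free = ∁hittingSet-APFree {m = m} d λ ap →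
    D⊆d (IsCyclicAP⇒D (n∣m*n m) (ℕ.<⇒≤ 3≤k) ap)
  lower : + mk - S ℤ.≤ + b mk k
  lower = begin
    + mk - S            ≤⟨ ℤ.+-monoʳ-≤ (+ mk) (ℤ.neg-mono-≤ (∣hittingSet∣≤ d d-mono m k d≤m)) ⟩
    + mk - + ∣ H ∣      ≡⟨ +-∸ (∣p∣≤n H) ⟨
    + (mk ∸ ∣ H ∣)      ≡⟨ cong +_ (∣∁p∣≡n∸∣p∣ H) ⟨
    + ∣ ∁ H ∣           ≤⟨ ℤ.+≤+ (b-upper k free) ⟩
    + b mk k            ∎
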